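{- Let $\mathcal X_1,\mathcal X_2,\mathcal W_1,\mathcal W_2$ be finite nonempty sets, let $g_1:\mathcal W_1\times\mathcal X_1\to[0,1]$ and $g_2:\mathcal W_2\times\mathcal X_2\to[0,1]$ be gain functions, and let $g:(\mathcal W_1\times\mathcal W_2)\times(\mathcal X_1\times\mathcal X_2)\to[0,1]$ be a joint gain function for $g_1,g_2$. For any jointly supported prior $\pi$ on $\mathcal X_1\times\mathcal X_2$ with marginals $\pi_1,\pi_2$ and with $V_g(\pi)>0$, $$H_g(\pi)\ \le\ H_{g_1}(\pi_1)+H_{g_2}(\pi_2)+\log M^{\max}_{g,\pi}.$$
   Context: A prior on a finite set $\mathcal X$ is a probability distribution on $\mathcal X$. For a gain function $g:\mathcal W\times\mathcal X\to[0,1]$: $V_g(\pi)=\max_{w\in\mathcal W}\sum_{x}\pi[x]g(w,x)$ and $H_g(\pi)=-\log V_g(\pi)$. Logarithms are to base 2. A joint gain function $g$ for $g_1,g_2$ is required to satisfy: $g((w_1,w_2),(x_1,x_2))=0$ if and only if $g_1(w_1,x_1)g_2(w_2,x_2)=0$ (no other relation is assumed). The marginals of $\pi$ are $\pi_1[x_1]=\sum_{x_2}\pi[x_1,x_2]$ and $\pi_2[x_2]=\sum_{x_1}\pi[x_1,x_2]$. $\pi$ is jointly supported if for all $x_1,x_2$, $\pi_1[x_1]\pi_2[x_2]\ne 0$ implies $\pi[x_1,x_2]\neq 0$. For $w_1\in\mathcal W_1,w_2\in\mathcal W_2$ let $\mathcal S_{w_1,w_2}=\{(x_1,x_2):\pi[x_1,x_2]\,g((w_1,w_2),(x_1,x_2))\ne0\}$.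 $M^{\max}_{g,\pi}$ is the maximum, over all $(w_1,w_2)\in\mathcal W_1\times\mathcal W_2$ and all $(x_1,x_2)\in\mathcal S_{w_1,w_2}$, of $$\frac{\pi_1[x_1]g_1(w_1,x_1)\cdot\pi_2[x_2]g_2(w_2,x_2)}{\pi[x_1,x_2]\cdot g((w_1,w_2),(x_1,x_2))}.$$ Pairs $(w_1,w_2)$ with $\mathcal S_{w_1,w_2}=\emptyset$ are ignored; $V_g(\pi)>0$ guarantees that some $\mathcal S_{w_1,w_2}$ is nonempty. -}

module Defs where

open import Algebra.Bundles using (CommutativeRing)
open import Algebra.Core using (Op₁; Op₂)
open import Algebra.Definitions using (Congruent₁)
open import Algebra.Structures using (IsCommutativeRing)
open import Data.List.Base using (List; []; _∷_; map; filter; foldr; cartesianProduct)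
open import Data.List.Membership.Propositional using (_∈_)
open import Data.List.Membership.Propositional.Properties using (∈-cartesianProduct⁺)
open import Data.List.Relation.Unary.Unique.Propositional using (Unique)
open import Data.List.Relation.Unary.Unique.Propositional.Properties using (cartesianProduct⁺)
open import Data.Nat.Base using (ℕ; suc)
open import Data.Product.Base using (_×_; _,_; ∃; ∃-syntax)
open import Function.Bundles using (_⇔_)
open import Level using (0ℓ)
open import Relation.Binary.Bundles using (DecTotalOrder)
open import Relation.Binary.Core using (Rel)
open import Relation.Binary.Structures using (IsDecTotalOrder)
open import Relation.Nullary using (¬_)
open import Relation.Nullary.Decidable using (¬?)
open import Relation.Unary using (Pred; Decidable)
import Algebra.Properties.Semiring.Exp as Exp
import Algebra.Properties.Semiring.Mult as Mult
import Data.List.Extrema as Extrema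
import Relation.Binary.Construct.NonStrictToStrict as NonStrictToStrict

-- The library has no real numbers.  Classically the complete ordered fields
-- are exactly the isomorphic copies of ℝ, so a statement about the reals is
-- rendered as a statement about every complete ordered field.  Decidability
-- of the order is part of the classical reading.
--
-- `_⁻¹` and `sup` are total; their values at 0# and at empty or unbounded
-- predicates are unspecified.
record CompleteOrderedField : Set₁ where
  infix  8 -_ _⁻¹
  infixl 7 _*_ _/_
  infixl 6 _+_
  infix  4 _≈_ _≉_ _≤_
  field
    Carrier : Set
    _≈_     : Rel Carrier 0ℓ
    _≤_     : Rel Carrier 0ℓ
    _+_     : Op₂ Carrier
    _*_     : Op₂ Carrier
    -_      : Op₁ Carrier
    _⁻¹     : Op₁ Carrier
    0#      : Carrier
    1#      : Carrier
    sup     : Pred Carrier 0ℓ → Carrier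

  _≉_ : Rel Carrier 0ℓ
  x ≉ y = ¬ (x ≈ y)

  UpperBound : Pred Carrier 0ℓ → Pred Carrier 0ℓ
  UpperBound P u = ∀ x → P x → x ≤ u

  LeastUpperBound : Pred Carrier 0ℓ → Pred Carrier 0ℓ
  LeastUpperBound P s = UpperBound P s × (∀ u → UpperBound P u → s ≤ u)

  field
    isCommutativeRing : IsCommutativeRing _≈_ _+_ _*_ -_ 0# 1#
    1≉0               : 1# ≉ 0#
    ⁻¹-cong           : Congruent₁ _≈_ _⁻¹
    ⁻¹-inverseʳ       : ∀ x → x ≉ 0# → x * x ⁻¹ ≈ 1#
    isDecTotalOrder   : IsDecTotalOrder _≈_ _≤_
    +-monoʳ-≤         : ∀ z {x y} → x ≤ y → z + x ≤ z + y
    *-nonneg          : ∀ {x y} → 0# ≤ x → 0# ≤ y → 0# ≤ x * y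
    sup-lub           : ∀ P → ∃ P → ∃ (UpperBound P) → LeastUpperBound P (sup P)

  commutativeRing : CommutativeRing 0ℓ 0ℓ
  commutativeRing = record { isCommutativeRing = isCommutativeRing }

  decTotalOrder : DecTotalOrder 0ℓ 0ℓ 0ℓ
  decTotalOrder = record { isDecTotalOrder = isDecTotalOrder }

  open DecTotalOrder decTotalOrder public using (_≟_; totalOrder)
  open NonStrictToStrict _≈_ _≤_ public using (_<_)
  open Exp (CommutativeRing.semiring commutativeRing) public using (_^_)
  open Mult (CommutativeRing.semiring commutativeRing) public
    using () renaming (_×_ to _·_)

  _/_ : Op₂ Carrier
  x / y = x * y ⁻¹

  -- For x > 0, log₂ x is the supremum of the rationals r = (a - b) / q, q ≥ 1,
  -- with 2 ^ r ≤ x; clearing the root and the negative exponent, the latter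
  -- says 2 ^ a ≤ x ^ q * 2 ^ b.
  log₂ : Op₁ Carrier
  log₂ x = sup λ r → ∃[ a ] ∃[ b ] ∃[ k ]
    (suc k · 1#) * r ≈ (a · 1#) + - (b · 1#) ×
    (1# + 1#) ^ a ≤ x ^ suc k * (1# + 1#) ^ b

  -- Only meaningful on nonempty lists.
  maximum : List Carrier → Carrier
  maximum []       = 0#
  maximum (x ∷ xs) = Extrema.max totalOrder x xs

-- A finite nonempty set, with an enumeration listing each element once.
record FiniteSet : Set₁ where
  field
    Elem     : Set
    elements : List Elem
    unique   : Unique elements
    complete : ∀ x → x ∈ elements
    nonempty : Elem

open FiniteSet public

infixr 2 _⊗_

_⊗_ : FiniteSet → FiniteSet → FiniteSet
X ⊗ Y = record
  { Elem     = Elem X × Elem Y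
  ; elements = cartesianProduct (elements X) (elements Y)
  ; unique   = cartesianProduct⁺ (unique X) (unique Y)
  ; complete = λ (x , y) → ∈-cartesianProduct⁺ (complete X x) (complete Y y)
  ; nonempty = nonempty X , nonempty Y
  }

module Leakage (ℝ : CompleteOrderedField) where
  open CompleteOrderedField ℝ renaming (Carrier to R)

  Σ[_] : (X : FiniteSet) → (Elem X → R) → R
  Σ[ X ] f = foldr _+_ 0# (map f (elements X))

  Max[_] : (X : FiniteSet) → (Elem X → R) → R
  Max[ X ] f = maximum (map f (elements X))

  record IsPrior (X : FiniteSet) (π : Elem X → R) : Set where
    field
      nonneg : ∀ x → 0# ≤ π x
      total  : Σ[ X ] π ≈ 1#

  IsGain : (W X : FiniteSet) → (Elem W × Elem X → R) → Set
  IsGain W X g = ∀ w x → 0# ≤ g (w , x) × g (w , x) ≤ 1#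

  V : (W X : FiniteSet) → (Elem W × Elem X → R) → (Elem X → R) → R
  V W X g π = Max[ W ] λ w → Σ[ X ] λ x → π x * g (w , x)

  H : (W X : FiniteSet) → (Elem W × Elem X → R) → (Elem X → R) → R
  H W X g π = - log₂ (V W X g π)

  module Joint (X₁ X₂ W₁ W₂ : FiniteSet) where

    marginal₁ : (Elem (X₁ ⊗ X₂) → R) → Elem X₁ → R
    marginal₁ π x₁ = Σ[ X₂ ] λ x₂ → π (x₁ , x₂)

    marginal₂ : (Elem (X₁ ⊗ X₂) → R) → Elem X₂ → R
    marginal₂ π x₂ = Σ[ X₁ ] λ x₁ → π (x₁ , x₂)

    JointlySupported : (Elem (X₁ ⊗ X₂) → R) → Set
    JointlySupported π =
      ∀ x₁ x₂ → marginal₁ π x₁ * marginal₂ π x₂ ≉ 0# → π (x₁ , x₂) ≉ 0#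

    module _ (g₁ : Elem W₁ × Elem X₁ → R) (g₂ : Elem W₂ × Elem X₂ → R)
             (g : Elem (W₁ ⊗ W₂) × Elem (X₁ ⊗ X₂) → R) where

      IsJointGain : Set
      IsJointGain = IsGain (W₁ ⊗ W₂) (X₁ ⊗ X₂) g ×
        (∀ w₁ w₂ x₁ x₂ →
          g ((w₁ , w₂) , (x₁ , x₂)) ≈ 0# ⇔ g₁ (w₁ , x₁) * g₂ (w₂ , x₂) ≈ 0#)

      module _ (π : Elem (X₁ ⊗ X₂) → R) where

        -- 𝒮 (w , x) says that x belongs to the set 𝒮 attached to the pair w.
        𝒮 : Pred (Elem ((W₁ ⊗ W₂) ⊗ (X₁ ⊗ X₂))) 0ℓ
        𝒮 (w , x) = π x * g (w , x) ≉ 0#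

        𝒮? : Decidable 𝒮
        𝒮? (w , x) = ¬? (π x * g (w , x) ≟ 0#)

        ratio : Elem ((W₁ ⊗ W₂) ⊗ (X₁ ⊗ X₂)) → R
        ratio ((w₁ , w₂) , (x₁ , x₂)) =
          ((marginal₁ π x₁ * g₁ (w₁ , x₁)) * (marginal₂ π x₂ * g₂ (w₂ , x₂)))
            / (π (x₁ , x₂) * g ((w₁ , w₂) , (x₁ , x₂)))

        Mᵐᵃˣ : R
        Mᵐᵃˣ = maximum (map ratio (filter 𝒮? (elements ((W₁ ⊗ W₂) ⊗ (X₁ ⊗ X₂)))))

{-# OPTIONS --safe #-}
module Submission where

-- Fix optimal guesses w₁ and w₂ and expand the product of the two sums into
-- V₁ V₂ = Σ (π₁ g₁)(π₂ g₂).  Each term is at most Mᵐᵃˣ π g: where π g ≠ 0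
-- by definition of Mᵐᵃˣ, and where π g = 0 because the term vanishes as well,
-- by joint support or by the joint gain condition.  Hence V₁ V₂ ≤ Mᵐᵃˣ V, and
-- it remains to take logarithms.  For log₂ defined as a supremum of rationals,
-- log₂ x + log₂ y ≤ log₂ (x y) follows by adding the rationals; the converse
-- reduces to 0 ≤ log₂ y + log₂ y⁻¹, since log₂ (x y) + log₂ y⁻¹ ≤ log₂ x.

open import Algebra.Bundles using (CommutativeRing)
open import Data.List.Base using (List; []; _∷_; _++_; map; foldr; cartesianProduct)
open import Data.List.Membership.Propositional using (_∈_)
open import Data.List.Membership.Propositional.Properties using (∈-map⁺; ∈-map⁻; ∈-filter⁺)
import Data.List.Relation.Unary.All as All
open import Data.List.Relation.Unary.Any using (here; there)
open import Data.Nat.Base as ℕ using (ℕ; zero; suc)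
import Data.Nat.Properties as ℕ
open import Data.Product.Base using (_×_; _,_; ∃; ∃-syntax; proj₁; proj₂)
open import Data.Sum.Base using (_⊎_; inj₁; inj₂)
open import Function.Base using (_∘_)
open import Function.Bundles using (Equivalence)
open import Relation.Binary.Bundles using (DecTotalOrder)
open import Relation.Binary.PropositionalEquality.Core as ≡ using (_≡_)
open import Relation.Nullary using (¬_; yes; no; contradiction)
open import Relation.Nullary.Decidable using (decidable-stable)
import Algebra.Properties.CommutativeSemiring.Exp as Exp
import Algebra.Properties.Ring as RingProperties
import Algebra.Properties.Semiring.Mult as Mult
import Algebra.Solver.Ring.NaturalCoefficients.Default as SemiringSolver
import Data.List.Extrema as Extrema
import Relation.Binary.Construct.NonStrictToStrict as NonStrictToStrict
import Relation.Binary.Reasoning.PartialOrder as ≤-Reasoning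

open import Defs

-- Arithmetic and order in an ordered field.

module OrderedField (ℝ : CompleteOrderedField) where
  open CompleteOrderedField ℝ
  open CommutativeRing commutativeRing public
    using (ring; semiring; commutativeSemiring; refl; reflexive; sym; trans
          ; +-cong; +-congˡ; +-congʳ; +-comm; +-assoc; +-identityˡ; +-identityʳ
          ; -‿inverseˡ; -‿inverseʳ; -‿cong
          ; *-cong; *-congˡ; *-congʳ; *-comm; *-assoc; *-identityˡ; *-identityʳ
          ; zeroˡ; zeroʳ; distribˡ; distribʳ)
  open DecTotalOrder decTotalOrder public
    using (_≤?_; poset; total)
    renaming (refl to ≤-refl; reflexive to ≤-reflexive; trans to ≤-trans; antisym to ≤-antisym)
  open RingProperties ring public using (-‿distribʳ-*; -‿involutive)
  open Exp commutativeSemiring public using (^-congˡ; ^-congʳ; ^-homo-*; ^-assocʳ; ^-distrib-*)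
  open Mult semiring public using (×-homo-+; ×1-homo-*)
  open SemiringSolver commutativeSemiring public using (solve; _:+_; _:*_; _:=_)
  open ≤-Reasoning poset public
  module Strict = NonStrictToStrict _≈_ _≤_

  ≤-stable : ∀ {x y} → ¬ ¬ (x ≤ y) → x ≤ y
  ≤-stable {x} {y} = decidable-stable (x ≤? y)

  ≰⇒> : ∀ {x y} → ¬ (x ≤ y) → y < x
  ≰⇒> = Strict.≰⇒> sym ≤-reflexive total

  <⇒≱ : ∀ {x y} → x < y → ¬ (y ≤ x)
  <⇒≱ = Strict.<⇒≱ ≤-antisym

  <-≤-trans : ∀ {x y z} → x < y → y ≤ z → x < z
  <-≤-trans {x} {y} {z} x<y y≤z = begin-strict x <⟨ x<y ⟩ y ≤⟨ y≤z ⟩ z ∎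

  0<⇒≉0 : ∀ {x} → 0# < x → x ≉ 0#
  0<⇒≉0 (_ , 0≉x) x≈0 = 0≉x (sym x≈0)

  +-monoˡ-≤ : ∀ z {x y} → x ≤ y → x + z ≤ y + z
  +-monoˡ-≤ z {x} {y} x≤y = begin
    x + z  ≈⟨ +-comm x z ⟩
    z + x  ≤⟨ +-monoʳ-≤ z x≤y ⟩
    z + y  ≈⟨ +-comm z y ⟩
    y + z  ∎

  +-mono-≤ : ∀ {w x y z} → w ≤ x → y ≤ z → w + y ≤ x + z
  +-mono-≤ w≤x y≤z = ≤-trans (+-monoˡ-≤ _ w≤x) (+-monoʳ-≤ _ y≤z)

  x+y-y≈x : ∀ x y → (x + y) + - y ≈ x
  x+y-y≈x x y = trans (+-assoc x y (- y)) (trans (+-congˡ (-‿inverseʳ y)) (+-identityʳ x))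

  x-y+y≈x : ∀ x y → (x + - y) + y ≈ x
  x-y+y≈x x y = trans (+-assoc x (- y) y) (trans (+-congˡ (-‿inverseˡ y)) (+-identityʳ x))

  x+y≤z⇒x≤z-y : ∀ {x y z} → x + y ≤ z → x ≤ z + - y
  x+y≤z⇒x≤z-y {x} {y} {z} p = begin
    x              ≈⟨ x+y-y≈x x y ⟨
    (x + y) + - y  ≤⟨ +-monoˡ-≤ (- y) p ⟩
    z + - y        ∎

  x≤z-y⇒x+y≤z : ∀ {x y z} → x ≤ z + - y → x + y ≤ z
  x≤z-y⇒x+y≤z {x} {y} {z} p = begin
    x + y          ≤⟨ +-monoˡ-≤ y p ⟩
    (z + - y) + y  ≈⟨ x-y+y≈x z y ⟩
    z              ∎

  +-cancelʳ-≤ : ∀ z {x y} → x + z ≤ y + z → x ≤ y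
  +-cancelʳ-≤ z {x} {y} p = begin
    x              ≤⟨ x+y≤z⇒x≤z-y p ⟩
    (y + z) + - z  ≈⟨ x+y-y≈x y z ⟩
    y              ∎

  -- The only order axiom for products concerns nonnegative factors, so it is applied to z and y -
  -- x.
  *-monoʳ-≤ : ∀ {z} → 0# ≤ z → ∀ {x y} → x ≤ y → z * x ≤ z * y
  *-monoʳ-≤ {z} 0≤z {x} {y} x≤y = begin
    z * x                  ≈⟨ +-identityˡ (z * x) ⟨
    0# + z * x             ≤⟨ +-monoˡ-≤ (z * x) (*-nonneg 0≤z (x+y≤z⇒x≤z-y 0+x≤y)) ⟩
    z * (y + - x) + z * x  ≈⟨ distribˡ z (y + - x) x ⟨
    z * ((y + - x) + x)    ≈⟨ *-congˡ (x-y+y≈x y x) ⟩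
    z * y                  ∎
    where
    0+x≤y : 0# + x ≤ y
    0+x≤y = ≤-trans (≤-reflexive (+-identityˡ x)) x≤y

  *-monoˡ-≤ : ∀ {z} → 0# ≤ z → ∀ {x y} → x ≤ y → x * z ≤ y * z
  *-monoˡ-≤ {z} 0≤z {x} {y} x≤y = begin
    x * z  ≈⟨ *-comm x z ⟩
    z * x  ≤⟨ *-monoʳ-≤ 0≤z x≤y ⟩
    z * y  ≈⟨ *-comm z y ⟩
    y * z  ∎

  *-mono-≤ : ∀ {w x y z} → 0# ≤ x → 0# ≤ y → w ≤ x → y ≤ z → w * y ≤ x * z
  *-mono-≤ 0≤x 0≤y w≤x y≤z = ≤-trans (*-monoˡ-≤ 0≤y w≤x) (*-monoʳ-≤ 0≤x y≤z)

  *-inverseˡ : ∀ {x} → x ≉ 0# → x ⁻¹ * x ≈ 1#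
  *-inverseˡ {x} x≉0 = trans (*-comm (x ⁻¹) x) (⁻¹-inverseʳ x x≉0)

  x*[x⁻¹*y]≈y : ∀ {x} → x ≉ 0# → ∀ y → x * (x ⁻¹ * y) ≈ y
  x*[x⁻¹*y]≈y {x} x≉0 y =
    trans (sym (*-assoc x (x ⁻¹) y)) (trans (*-congʳ (⁻¹-inverseʳ x x≉0)) (*-identityˡ y))

  x⁻¹*[x*y]≈y : ∀ {x} → x ≉ 0# → ∀ y → x ⁻¹ * (x * y) ≈ y
  x⁻¹*[x*y]≈y {x} x≉0 y =
    trans (sym (*-assoc (x ⁻¹) x y)) (trans (*-congʳ (*-inverseˡ x≉0)) (*-identityˡ y))

  y/x*x≈y : ∀ {x} → x ≉ 0# → ∀ y → (y / x) * x ≈ y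
  y/x*x≈y {x} x≉0 y =
    trans (*-assoc y (x ⁻¹) x) (trans (*-congˡ (*-inverseˡ x≉0)) (*-identityʳ y))

  *-cancelˡ-≈ : ∀ {z} → z ≉ 0# → ∀ {x y} → z * x ≈ z * y → x ≈ y
  *-cancelˡ-≈ z≉0 {x} {y} p =
    trans (sym (x⁻¹*[x*y]≈y z≉0 x)) (trans (*-congˡ p) (x⁻¹*[x*y]≈y z≉0 y))

  *-≉0 : ∀ {x y} → x ≉ 0# → y ≉ 0# → x * y ≉ 0#
  *-≉0 {x} x≉0 y≉0 xy≈0 = y≉0 (*-cancelˡ-≈ x≉0 (trans xy≈0 (sym (zeroʳ x))))

  *-pos : ∀ {x y} → 0# < x → 0# < y → 0# < x * y
  *-pos 0<x@(0≤x , _) 0<y@(0≤y , _) =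
    *-nonneg 0≤x 0≤y , *-≉0 (0<⇒≉0 0<x) (0<⇒≉0 0<y) ∘ sym

  *-cancelˡ-≤ : ∀ {z} → 0# < z → ∀ {x y} → z * x ≤ z * y → x ≤ y
  *-cancelˡ-≤ 0<z@(0≤z , _) {x} {y} zx≤zy with total x y
  ... | inj₁ x≤y = x≤y
  ... | inj₂ y≤x =
    ≤-reflexive (*-cancelˡ-≈ (0<⇒≉0 0<z) (≤-antisym zx≤zy (*-monoʳ-≤ 0≤z y≤x)))

  0≤1 : 0# ≤ 1#
  0≤1 with total 0# 1#
  ... | inj₁ 0≤1 = 0≤1
  -- If 1 ≤ 0, then -1 is nonnegative, and hence so is its square, which is 1.
  ... | inj₂ 1≤0 = begin
    0#             ≤⟨ *-nonneg 0≤-1 0≤-1 ⟩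
    - 1# * - 1#    ≈⟨ -‿distribʳ-* (- 1#) 1# ⟨
    - (- 1# * 1#)  ≈⟨ -‿cong (*-identityʳ (- 1#)) ⟩
    - (- 1#)       ≈⟨ -‿involutive 1# ⟩
    1#             ∎
    where
    0≤-1 : 0# ≤ - 1#
    0≤-1 = begin
      0#         ≤⟨ x+y≤z⇒x≤z-y (≤-trans (≤-reflexive (+-identityˡ 1#)) 1≤0) ⟩
      0# + - 1#  ≈⟨ +-identityˡ (- 1#) ⟩
      - 1#       ∎

  0<1 : 0# < 1#
  0<1 = 0≤1 , 1≉0 ∘ sym

  x≤x+y : ∀ x {y} → 0# ≤ y → x ≤ x + y
  x≤x+y x {y} 0≤y = begin
    x       ≈⟨ +-identityʳ x ⟨
    x + 0#  ≤⟨ +-monoʳ-≤ x 0≤y ⟩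
    x + y   ∎

  x<x+1 : ∀ x → x < x + 1#
  x<x+1 x = x≤x+y x 0≤1 , λ x≈x+1 → 1≉0 (begin-equality
    1#                ≈⟨ x+y-y≈x 1# x ⟨
    (1# + x) + - x    ≈⟨ +-congʳ (+-comm 1# x) ⟩
    (x + 1#) + - x    ≈⟨ +-congʳ x≈x+1 ⟨
    x + - x           ≈⟨ -‿inverseʳ x ⟩
    0#                ∎)

  ⁻¹-pos : ∀ {x} → 0# < x → 0# < x ⁻¹
  ⁻¹-pos {x} 0<x@(0≤x , _) = ≰⇒> λ x⁻¹≤0 → <⇒≱ 0<1 (begin
    1#        ≈⟨ ⁻¹-inverseʳ x (0<⇒≉0 0<x) ⟨
    x * x ⁻¹  ≤⟨ *-monoʳ-≤ 0≤x x⁻¹≤0 ⟩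
    x * 0#    ≈⟨ zeroʳ x ⟩
    0#        ∎)

  ^-pos : ∀ {x} → 0# < x → ∀ n → 0# < x ^ n
  ^-pos 0<x zero    = 0<1
  ^-pos 0<x (suc n) = *-pos 0<x (^-pos 0<x n)

  ^-monoˡ-≤ : ∀ {x y} → 0# < x → x ≤ y → ∀ n → x ^ n ≤ y ^ n
  ^-monoˡ-≤ 0<x x≤y zero    = ≤-refl
  ^-monoˡ-≤ 0<x x≤y (suc n) =
    *-mono-≤ (≤-trans (proj₁ 0<x) x≤y) (proj₁ (^-pos 0<x n)) x≤y (^-monoˡ-≤ 0<x x≤y n)

  1^n≈1 : ∀ n → 1# ^ n ≈ 1#
  1^n≈1 zero    = refl
  1^n≈1 (suc n) = trans (*-identityˡ _) (1^n≈1 n)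

-- The Archimedean property, powers of two and the binary logarithm.

module Logarithm (ℝ : CompleteOrderedField) where
  open CompleteOrderedField ℝ
  open OrderedField ℝ

  2# : Carrier
  2# = 1# + 1#

  ⟦_⟧ : ℕ → Carrier
  ⟦ n ⟧ = n · 1#

  ⟦⟧-nonneg : ∀ n → 0# ≤ ⟦ n ⟧
  ⟦⟧-nonneg zero    = ≤-refl
  ⟦⟧-nonneg (suc n) = ≤-trans 0≤1 (x≤x+y 1# (⟦⟧-nonneg n))

  ⟦⟧-pos : ∀ n → 0# < ⟦ suc n ⟧
  ⟦⟧-pos n = <-≤-trans 0<1 (x≤x+y 1# (⟦⟧-nonneg n))

  ⟦⟧-mono-≤ : ∀ {m n} → m ℕ.≤ n → ⟦ m ⟧ ≤ ⟦ n ⟧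
  ⟦⟧-mono-≤ {n = n} ℕ.z≤n = ⟦⟧-nonneg n
  ⟦⟧-mono-≤ (ℕ.s≤s m≤n)   = +-monoʳ-≤ 1# (⟦⟧-mono-≤ m≤n)

  ⟦⟧-homo-+ : ∀ m n → ⟦ m ℕ.+ n ⟧ ≈ ⟦ m ⟧ + ⟦ n ⟧
  ⟦⟧-homo-+ = ×-homo-+ 1#

  ⟦⟧-homo-* : ∀ m n → ⟦ m ℕ.* n ⟧ ≈ ⟦ m ⟧ * ⟦ n ⟧
  ⟦⟧-homo-* = ×1-homo-*

  -- A bound z would give the naturals a supremum s. Every n satisfies n + 1 ≤ s, so s - 1 would be
  -- a smaller upper bound.
  ℕ-unbounded : ∀ z → ¬ (∀ n → ⟦ n ⟧ ≤ z)
  ℕ-unbounded z ⟦n⟧≤z = <⇒≱ (x<x+1 s) (x≤z-y⇒x+y≤z (least (s + - 1#) s-1-upper))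
    where
    Natural : Carrier → Set
    Natural r = ∃[ n ] r ≈ ⟦ n ⟧

    s : Carrier
    s = sup Natural

    lub : LeastUpperBound Natural s
    lub = sup-lub Natural (0# , 0 , refl)
      (z , λ r (n , r≈n) → ≤-trans (≤-reflexive r≈n) (⟦n⟧≤z n))

    least = proj₂ lub

    s-1-upper : UpperBound Natural (s + - 1#)
    s-1-upper r (n , r≈n) = x+y≤z⇒x≤z-y (begin
      r + 1#       ≈⟨ +-congʳ r≈n ⟩
      ⟦ n ⟧ + 1#   ≈⟨ +-comm ⟦ n ⟧ 1# ⟩
      ⟦ suc n ⟧    ≤⟨ proj₁ lub ⟦ suc n ⟧ (suc n , refl) ⟩
      s            ∎)

  -- Completeness refutes a bound on all naturals but computes no n, hence the double negation.
  archimedean : ∀ z → ¬ ¬ (∃[ n ] z ≤ ⟦ n ⟧)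
  archimedean z ∄n = ℕ-unbounded z λ n → proj₁ (≰⇒> (∄n ∘ (n ,_)))

  0<2 : 0# < 2#
  0<2 = <-≤-trans 0<1 (x≤x+y 1# 0≤1)

  0≤2^ : ∀ n → 0# ≤ 2# ^ n
  0≤2^ n = proj₁ (^-pos 0<2 n)

  2*x≈x+x : ∀ x → 2# * x ≈ x + x
  2*x≈x+x x = trans (distribʳ x 1# 1#) (+-cong (*-identityˡ x) (*-identityˡ x))

  1≤2^ : ∀ n → 1# ≤ 2# ^ n
  1≤2^ zero    = ≤-refl
  1≤2^ (suc n) = begin
    1#               ≤⟨ 1≤2^ n ⟩
    2# ^ n           ≤⟨ x≤x+y (2# ^ n) (0≤2^ n) ⟩
    2# ^ n + 2# ^ n  ≈⟨ 2*x≈x+x (2# ^ n) ⟨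
    2# ^ suc n       ∎

  ⟦n⟧≤2^n : ∀ n → ⟦ n ⟧ ≤ 2# ^ n
  ⟦n⟧≤2^n zero    = 0≤1
  ⟦n⟧≤2^n (suc n) = begin
    1# + ⟦ n ⟧       ≤⟨ +-mono-≤ (1≤2^ n) (⟦n⟧≤2^n n) ⟩
    2# ^ n + 2# ^ n  ≈⟨ 2*x≈x+x (2# ^ n) ⟨
    2# ^ suc n       ∎

  -- Factors 2 are cancelled until one exponent is 0. If only n is exhausted, 2 ^ (m + 1) is at
  -- least 2 and cannot be below 1.
  2^-cancel-≤ : ∀ m n → 2# ^ m ≤ 2# ^ n → m ℕ.≤ n
  2^-cancel-≤ zero    n       _ = ℕ.z≤n
  2^-cancel-≤ (suc m) zero    p = contradiction p (<⇒≱ (begin-strict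
    1#               <⟨ x<x+1 1# ⟩
    1# + 1#          ≤⟨ +-mono-≤ (1≤2^ m) (1≤2^ m) ⟩
    2# ^ m + 2# ^ m  ≈⟨ 2*x≈x+x (2# ^ m) ⟨
    2# ^ suc m       ∎))
  2^-cancel-≤ (suc m) (suc n) p = ℕ.s≤s (2^-cancel-≤ m n (*-cancelˡ-≤ 0<2 p))

  ≤2^ : ∀ x → ¬ ¬ (∃[ n ] x ≤ 2# ^ n)
  ≤2^ x ∄n = archimedean x λ (n , x≤n) → ∄n (n , ≤-trans x≤n (⟦n⟧≤2^n n))

  -- 2 ^ r ≤ x, for the rational r = (a - b) / (k + 1).
  _Below_ : Carrier → Carrier → Set
  r Below x = ∃[ a ] ∃[ b ] ∃[ k ]
    ⟦ suc k ⟧ * r ≈ ⟦ a ⟧ + - ⟦ b ⟧ ×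
    2# ^ a ≤ x ^ suc k * 2# ^ b

  -- From 2 ^ a ≤ x ^ q * 2 ^ b ≤ 2 ^ (n q + b) follows a ≤ n q + b, that is, (a - b) / q ≤ n.
  Below-bounded : ∀ {x} n → 0# < x → x ≤ 2# ^ n → UpperBound (_Below x) ⟦ n ⟧
  Below-bounded {x} n 0<x x≤2^n r (a , b , k , qr≈a-b , 2^a≤) =
    *-cancelˡ-≤ (⟦⟧-pos k) (begin
      ⟦ q ⟧ * r                          ≈⟨ qr≈a-b ⟩
      ⟦ a ⟧ + - ⟦ b ⟧                    ≤⟨ +-monoˡ-≤ (- ⟦ b ⟧) (⟦⟧-mono-≤ a≤nq+b) ⟩
      ⟦ n ℕ.* q ℕ.+ b ⟧ + - ⟦ b ⟧        ≈⟨ +-congʳ (⟦⟧-homo-+ (n ℕ.* q) b) ⟩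
      (⟦ n ℕ.* q ⟧ + ⟦ b ⟧) + - ⟦ b ⟧    ≈⟨ x+y-y≈x ⟦ n ℕ.* q ⟧ ⟦ b ⟧ ⟩
      ⟦ n ℕ.* q ⟧                        ≈⟨ ⟦⟧-homo-* n q ⟩
      ⟦ n ⟧ * ⟦ q ⟧                      ≈⟨ *-comm ⟦ n ⟧ ⟦ q ⟧ ⟩
      ⟦ q ⟧ * ⟦ n ⟧                      ∎)
    where
    q = suc k

    a≤nq+b : a ℕ.≤ n ℕ.* q ℕ.+ b
    a≤nq+b = 2^-cancel-≤ a _ (begin
      2# ^ a                     ≤⟨ 2^a≤ ⟩
      x ^ q * 2# ^ b             ≤⟨ *-monoˡ-≤ (0≤2^ b) (^-monoˡ-≤ 0<x x≤2^n q) ⟩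
      (2# ^ n) ^ q * 2# ^ b      ≈⟨ *-congʳ (^-assocʳ 2# n q) ⟩
      2# ^ (n ℕ.* q) * 2# ^ b    ≈⟨ ^-homo-* 2# (n ℕ.* q) b ⟨
      2# ^ (n ℕ.* q ℕ.+ b)       ∎)

  -- The witness is the exponent -n, written as (0 - n) / 1: the bound on the inverse of x says 1 ≤
  -- x * 2 ^ n.
  Below-inhabited : ∀ {x} n → 0# < x → x ⁻¹ ≤ 2# ^ n → ∃ (_Below x)
  Below-inhabited {x} n 0<x x⁻¹≤2^n = 0# + - ⟦ n ⟧ , 0 , n , 0 , 1*r≈r , (begin
    1#                 ≈⟨ ⁻¹-inverseʳ x (0<⇒≉0 0<x) ⟨
    x * x ⁻¹           ≤⟨ *-monoʳ-≤ (proj₁ 0<x) x⁻¹≤2^n ⟩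
    x * 2# ^ n         ≈⟨ *-congʳ (*-identityʳ x) ⟨
    x ^ 1 * 2# ^ n     ∎)
    where
    1*r≈r : ⟦ 1 ⟧ * (0# + - ⟦ n ⟧) ≈ 0# + - ⟦ n ⟧
    1*r≈r = trans (*-congʳ (+-identityʳ 1#)) (*-identityˡ _)

  -- A power of two above x bounds the exponents, and one above `x ⁻¹` provides an exponent. Both
  -- powers are known only under double negation, and so is the conclusion.
  log₂-lub : ∀ {x} → 0# < x → ¬ ¬ LeastUpperBound (_Below x) (log₂ x)
  log₂-lub {x} 0<x ¬lub =
    ≤2^ x λ (m , x≤2^m) → ≤2^ (x ⁻¹) λ (n , x⁻¹≤2^n) →
    ¬lub (sup-lub (_Below x) (Below-inhabited n 0<x x⁻¹≤2^n)
                             (⟦ m ⟧ , Below-bounded m 0<x x≤2^m))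

  -- The order is decidable, hence ¬¬-stable, which is enough to use
  -- the bounds that `archimedean` supplies only under ¬ ¬.
  log₂-upper : ∀ {x} → 0# < x → UpperBound (_Below x) (log₂ x)
  log₂-upper 0<x r r-below = ≤-stable λ r≰ → log₂-lub 0<x λ (upper , _) → r≰ (upper r r-below)

  log₂-least : ∀ {x} → 0# < x → ∀ u → UpperBound (_Below x) u → log₂ x ≤ u
  log₂-least 0<x u u-upper = ≤-stable λ ≰u → log₂-lub 0<x λ (_ , least) → ≰u (least u u-upper)

  log₂-mono-≤ : ∀ {x y} → 0# < x → x ≤ y → log₂ x ≤ log₂ y
  log₂-mono-≤ {x} {y} 0<x x≤y = log₂-least 0<x (log₂ y)
    λ r (a , b , k , qr≈a-b , 2^a≤) → log₂-upper (<-≤-trans 0<x x≤y) r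
      (a , b , k , qr≈a-b , ≤-trans 2^a≤ (*-monoˡ-≤ (0≤2^ b) (^-monoˡ-≤ 0<x x≤y (suc k))))

  -- Over the common denominator p q, the sum of (a - b) / p and (c - d) / q has numerator (a q + c
  -- p) - (b q + d p). Accordingly the bound for x is raised to the power q, the one for y to the
  -- power p, and the two are multiplied.
  Below-* : ∀ {x y r s} → 0# < x → 0# < y → r Below x → s Below y → (r + s) Below (x * y)
  Below-* {x} {y} {r} {s} 0<x 0<y (a , b , k , pr≈a-b , 2^a≤) (c , d , l , qs≈c-d , 2^c≤) =
    -- The third witness is the predecessor of the denominator: `suc (l ℕ.+ k ℕ.* q)` is what
    -- `p ℕ.* q` computes to.
    a ℕ.* q ℕ.+ c ℕ.* p , b ℕ.* q ℕ.+ d ℕ.* p , l ℕ.+ k ℕ.* q , exponent , bound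
    where
    p = suc k
    q = suc l

    pr+b≈a : ⟦ p ⟧ * r + ⟦ b ⟧ ≈ ⟦ a ⟧
    pr+b≈a = trans (+-congʳ pr≈a-b) (x-y+y≈x ⟦ a ⟧ ⟦ b ⟧)

    qs+d≈c : ⟦ q ⟧ * s + ⟦ d ⟧ ≈ ⟦ c ⟧
    qs+d≈c = trans (+-congʳ qs≈c-d) (x-y+y≈x ⟦ c ⟧ ⟦ d ⟧)

    ⟦⟧-homo-+* : ∀ m n → ⟦ m ℕ.* q ℕ.+ n ℕ.* p ⟧ ≈ ⟦ m ⟧ * ⟦ q ⟧ + ⟦ n ⟧ * ⟦ p ⟧
    ⟦⟧-homo-+* m n = trans (⟦⟧-homo-+ (m ℕ.* q) (n ℕ.* p)) (+-cong (⟦⟧-homo-* m q) (⟦⟧-homo-* n p))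

    exponent : ⟦ p ℕ.* q ⟧ * (r + s) ≈ ⟦ a ℕ.* q ℕ.+ c ℕ.* p ⟧ + - ⟦ b ℕ.* q ℕ.+ d ℕ.* p ⟧
    exponent = begin-equality
      ⟦ p ℕ.* q ⟧ * (r + s)
        ≈⟨ x+y-y≈x _ ⟦ b ℕ.* q ℕ.+ d ℕ.* p ⟧ ⟨
      (⟦ p ℕ.* q ⟧ * (r + s) + ⟦ b ℕ.* q ℕ.+ d ℕ.* p ⟧) + - ⟦ b ℕ.* q ℕ.+ d ℕ.* p ⟧
        ≈⟨ +-congʳ (+-cong (*-congʳ (⟦⟧-homo-* p q)) (⟦⟧-homo-+* b d)) ⟩
      ((⟦ p ⟧ * ⟦ q ⟧) * (r + s) + (⟦ b ⟧ * ⟦ q ⟧ + ⟦ d ⟧ * ⟦ p ⟧)) + - ⟦ b ℕ.* q ℕ.+ d ℕ.* p ⟧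
        -- The solver handles commutative semirings, so the negative parts b and d have first been
        -- moved to the side of r and s.
        ≈⟨ +-congʳ (solve 6 (λ P Q R S B D →
             (P :* Q) :* (R :+ S) :+ (B :* Q :+ D :* P) :=
             (P :* R :+ B) :* Q :+ (Q :* S :+ D) :* P) refl ⟦ p ⟧ ⟦ q ⟧ r s ⟦ b ⟧ ⟦ d ⟧) ⟩
      ((⟦ p ⟧ * r + ⟦ b ⟧) * ⟦ q ⟧ + (⟦ q ⟧ * s + ⟦ d ⟧) * ⟦ p ⟧) + - ⟦ b ℕ.* q ℕ.+ d ℕ.* p ⟧
        ≈⟨ +-congʳ (+-cong (*-congʳ pr+b≈a) (*-congʳ qs+d≈c)) ⟩
      (⟦ a ⟧ * ⟦ q ⟧ + ⟦ c ⟧ * ⟦ p ⟧) + - ⟦ b ℕ.* q ℕ.+ d ℕ.* p ⟧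
        ≈⟨ +-congʳ (⟦⟧-homo-+* a c) ⟨
      ⟦ a ℕ.* q ℕ.+ c ℕ.* p ⟧ + - ⟦ b ℕ.* q ℕ.+ d ℕ.* p ⟧ ∎

    2^-homo-+* : ∀ m n → 2# ^ (m ℕ.* q ℕ.+ n ℕ.* p) ≈ (2# ^ m) ^ q * (2# ^ n) ^ p
    2^-homo-+* m n = trans (^-homo-* 2# (m ℕ.* q) (n ℕ.* p))
      (*-cong (sym (^-assocʳ 2# m q)) (sym (^-assocʳ 2# n p)))

    bound : 2# ^ (a ℕ.* q ℕ.+ c ℕ.* p) ≤ (x * y) ^ (p ℕ.* q) * 2# ^ (b ℕ.* q ℕ.+ d ℕ.* p)
    bound = begin
      2# ^ (a ℕ.* q ℕ.+ c ℕ.* p)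
        ≈⟨ 2^-homo-+* a c ⟩
      (2# ^ a) ^ q * (2# ^ c) ^ p
        ≤⟨ *-mono-≤ (proj₁ (^-pos (*-pos (^-pos 0<x p) (^-pos 0<2 b)) q))
             (proj₁ (^-pos (^-pos 0<2 c) p))
             (^-monoˡ-≤ (^-pos 0<2 a) 2^a≤ q) (^-monoˡ-≤ (^-pos 0<2 c) 2^c≤ p) ⟩
      (x ^ p * 2# ^ b) ^ q * (y ^ q * 2# ^ d) ^ p
        ≈⟨ *-cong (^-distrib-* (x ^ p) (2# ^ b) q) (^-distrib-* (y ^ q) (2# ^ d) p) ⟩
      ((x ^ p) ^ q * (2# ^ b) ^ q) * ((y ^ q) ^ p * (2# ^ d) ^ p)
        ≈⟨ *-cong (*-congʳ (^-assocʳ x p q))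
             (*-congʳ (trans (^-assocʳ y q p) (^-congʳ y (ℕ.*-comm q p)))) ⟩
      (x ^ (p ℕ.* q) * (2# ^ b) ^ q) * (y ^ (p ℕ.* q) * (2# ^ d) ^ p)
        ≈⟨ solve 4 (λ X B Y D → (X :* B) :* (Y :* D) := (X :* Y) :* (B :* D)) refl _ _ _ _ ⟩
      (x ^ (p ℕ.* q) * y ^ (p ℕ.* q)) * ((2# ^ b) ^ q * (2# ^ d) ^ p)
        ≈⟨ *-cong (^-distrib-* x y (p ℕ.* q)) (2^-homo-+* b d) ⟨
      (x * y) ^ (p ℕ.* q) * 2# ^ (b ℕ.* q ℕ.+ d ℕ.* p) ∎

  -- The least-upper-bound property is used twice. The outer use replaces log₂ x by an arbitrary r
  -- below it, the inner one, with r fixed, replaces log₂ y by s. Then r + s is an exponent for x y.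
  log₂-superadditive : ∀ {x y} → 0# < x → 0# < y → log₂ x + log₂ y ≤ log₂ (x * y)
  log₂-superadditive {x} {y} 0<x 0<y =
    x≤z-y⇒x+y≤z (log₂-least 0<x _ λ r r-below → x+y≤z⇒x≤z-y (begin
      r + log₂ y    ≈⟨ +-comm r (log₂ y) ⟩
      log₂ y + r    ≤⟨ x≤z-y⇒x+y≤z (log₂-least 0<y _ λ s s-below → x+y≤z⇒x≤z-y (begin
        s + r          ≈⟨ +-comm s r ⟩
        r + s          ≤⟨ log₂-upper (*-pos 0<x 0<y) (r + s) (Below-* 0<x 0<y r-below s-below) ⟩
        log₂ (x * y)   ∎)) ⟩
      log₂ (x * y)  ∎))

  -- This is (a - b) / q ≤ log₂ x with the division and the subtraction cleared, so that instances
  -- for x and for `x ⁻¹` can simply be added.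
  ⟦a⟧≤q*log₂x+⟦b⟧ : ∀ {x} → 0# < x → ∀ a b k → 2# ^ a ≤ x ^ suc k * 2# ^ b →
                ⟦ a ⟧ ≤ ⟦ suc k ⟧ * log₂ x + ⟦ b ⟧
  ⟦a⟧≤q*log₂x+⟦b⟧ {x} 0<x a b k 2^a≤ = begin
    ⟦ a ⟧                            ≈⟨ x-y+y≈x ⟦ a ⟧ ⟦ b ⟧ ⟨
    (⟦ a ⟧ + - ⟦ b ⟧) + ⟦ b ⟧        ≈⟨ +-congʳ q*r≈a-b ⟨
    ⟦ suc k ⟧ * r + ⟦ b ⟧            ≤⟨ +-monoˡ-≤ ⟦ b ⟧ (*-monoʳ-≤ (⟦⟧-nonneg (suc k)) r≤log₂x) ⟩
    ⟦ suc k ⟧ * log₂ x + ⟦ b ⟧       ∎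
    where
    r : Carrier
    r = ⟦ suc k ⟧ ⁻¹ * (⟦ a ⟧ + - ⟦ b ⟧)

    q*r≈a-b : ⟦ suc k ⟧ * r ≈ ⟦ a ⟧ + - ⟦ b ⟧
    q*r≈a-b = x*[x⁻¹*y]≈y (0<⇒≉0 (⟦⟧-pos k)) _

    r≤log₂x : r ≤ log₂ x
    r≤log₂x = log₂-upper 0<x r (a , b , k , q*r≈a-b , 2^a≤)

  -- Compare 2 ^ a with x ^ q * 2 ^ b. If the former is smaller, (a - b) / q is an exponent for x.
  -- Otherwise multiplying by the q-th power of `x ⁻¹` makes (b - a) / q an exponent for `x ⁻¹`.
  log₂-dichotomy : ∀ {x} → 0# < x → ∀ a b k →
                   ⟦ a ⟧ ≤ ⟦ suc k ⟧ * log₂ x + ⟦ b ⟧ ⊎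
                   ⟦ b ⟧ ≤ ⟦ suc k ⟧ * log₂ (x ⁻¹) + ⟦ a ⟧
  log₂-dichotomy {x} 0<x a b k with total (2# ^ a) (x ^ suc k * 2# ^ b)
  ... | inj₁ 2^a≤ = inj₁ (⟦a⟧≤q*log₂x+⟦b⟧ 0<x a b k 2^a≤)
  ... | inj₂ ≤2^a = inj₂ (⟦a⟧≤q*log₂x+⟦b⟧ 0<x⁻¹ b a k (begin
    2# ^ b                                  ≈⟨ x⁻¹^q*[x^q*y]≈y ⟨
    (x ⁻¹) ^ suc k * (x ^ suc k * 2# ^ b)   ≤⟨ *-monoʳ-≤ (proj₁ (^-pos 0<x⁻¹ (suc k))) ≤2^a ⟩
    (x ⁻¹) ^ suc k * 2# ^ a                 ∎))
    where
    0<x⁻¹ = ⁻¹-pos 0<x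

    x⁻¹^q*[x^q*y]≈y : ∀ {y} → (x ⁻¹) ^ suc k * (x ^ suc k * y) ≈ y
    x⁻¹^q*[x^q*y]≈y {y} = begin-equality
      (x ⁻¹) ^ suc k * (x ^ suc k * y)   ≈⟨ *-assoc _ _ y ⟨
      ((x ⁻¹) ^ suc k * x ^ suc k) * y   ≈⟨ *-congʳ (^-distrib-* (x ⁻¹) x (suc k)) ⟨
      (x ⁻¹ * x) ^ suc k * y             ≈⟨ *-congʳ (^-congˡ (suc k) (*-inverseˡ (0<⇒≉0 0<x))) ⟩
      1# ^ suc k * y                     ≈⟨ *-congʳ (1^n≈1 (suc k)) ⟩
      1# * y                             ≈⟨ *-identityˡ y ⟩
      y                                  ∎

  -- Otherwise some multiple q = k + 1 makes q (log₂ x + log₂ x⁻¹) < -1; but then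
  -- the dichotomy at the exponents (i + 1 - n) / q carries (i - n) / q ≤ log₂ x
  -- over to i + 1, so that log₂ x would be unbounded.
  log₂-⁻¹ : ∀ {x} → 0# < x → 0# ≤ log₂ x + log₂ (x ⁻¹)
  log₂-⁻¹ {x} 0<x = ≤-stable λ 0≰u+v →
    -- With D = -(u + v) > 0, k ≥ 1 / D gives only 1 ≤ D k; the successor q = k + 1 makes 1 < q D
    -- strict. The shift n ≥ -q u is what starts the climb at i = 0.
    archimedean ((- (u + v)) ⁻¹) λ (k , D⁻¹≤k) →
    archimedean (- (⟦ suc k ⟧ * u)) λ (n , -qu≤n) →
    ℕ-unbounded (⟦ suc k ⟧ * u + ⟦ n ⟧) (climb k n (≰⇒> 0≰u+v) D⁻¹≤k -qu≤n)
    where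
    u = log₂ x
    v = log₂ (x ⁻¹)

    module _ (k n : ℕ) (u+v<0 : u + v < 0#) (D⁻¹≤k : (- (u + v)) ⁻¹ ≤ ⟦ k ⟧)
             (-qu≤n : - (⟦ suc k ⟧ * u) ≤ ⟦ n ⟧) where

      D q : Carrier
      D = - (u + v)
      q = ⟦ suc k ⟧

      0<D : 0# < D
      0<D = ≰⇒> λ D≤0 → <⇒≱ u+v<0 (begin
        0#               ≈⟨ -‿inverseʳ (u + v) ⟨
        (u + v) + D      ≤⟨ +-monoʳ-≤ (u + v) D≤0 ⟩
        (u + v) + 0#     ≈⟨ +-identityʳ (u + v) ⟩
        u + v            ∎)

      1<q*D : 1# < q * D
      1<q*D = begin-strict
        1#               ≈⟨ ⁻¹-inverseʳ D (0<⇒≉0 0<D) ⟨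
        D * D ⁻¹         ≤⟨ *-monoʳ-≤ (proj₁ 0<D) D⁻¹≤k ⟩
        D * ⟦ k ⟧        <⟨ *-monoʳ-< ⟩
        D * q            ≈⟨ *-comm D q ⟩
        q * D            ∎
        where
        *-monoʳ-< : D * ⟦ k ⟧ < D * q
        *-monoʳ-< = ≰⇒> λ Dq≤Dk → <⇒≱ (x<x+1 ⟦ k ⟧) (begin
          ⟦ k ⟧ + 1#     ≈⟨ +-comm ⟦ k ⟧ 1# ⟩
          q              ≤⟨ *-cancelˡ-≤ 0<D Dq≤Dk ⟩
          ⟦ k ⟧          ∎)

      climb : ∀ i → ⟦ i ⟧ ≤ q * u + ⟦ n ⟧
      climb zero = begin
        0#                    ≈⟨ -‿inverseʳ (q * u) ⟨
        q * u + - (q * u)     ≤⟨ +-monoʳ-≤ (q * u) -qu≤n ⟩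
        q * u + ⟦ n ⟧         ∎
      climb (suc i) with log₂-dichotomy 0<x (suc i) n k
      ... | inj₁ i+1≤qu+n = i+1≤qu+n
      ... | inj₂ n≤qv+i+1 = contradiction q*D≤1 (<⇒≱ 1<q*D)
        where
        -- The bound already reached at i and the second alternative at i + 1 are added. The terms i
        -- + n cancel and a single 1 is left over, too little to offset q (u + v) = -q D < -1.
        0≤q[u+v]+1 : 0# ≤ q * (u + v) + 1#
        0≤q[u+v]+1 = +-cancelʳ-≤ (⟦ i ⟧ + ⟦ n ⟧) (begin
          0# + (⟦ i ⟧ + ⟦ n ⟧)                        ≈⟨ +-identityˡ _ ⟩
          ⟦ i ⟧ + ⟦ n ⟧                               ≤⟨ +-mono-≤ (climb i) n≤qv+i+1 ⟩
          (q * u + ⟦ n ⟧) + (q * v + (1# + ⟦ i ⟧))    ≈⟨ solve 6 (λ Q U V N I O →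
            (Q :* U :+ N) :+ (Q :* V :+ (O :+ I)) := (Q :* (U :+ V) :+ O) :+ (I :+ N))
            refl q u v ⟦ n ⟧ ⟦ i ⟧ 1# ⟩
          (q * (u + v) + 1#) + (⟦ i ⟧ + ⟦ n ⟧)        ∎)

        q*D≤1 : q * D ≤ 1#
        q*D≤1 = begin
          q * D                              ≈⟨ +-identityˡ (q * D) ⟨
          0# + q * D                         ≤⟨ +-monoˡ-≤ (q * D) 0≤q[u+v]+1 ⟩
          (q * (u + v) + 1#) + q * D         ≈⟨ solve 4 (λ Q S O D →
            (Q :* S :+ O) :+ Q :* D := Q :* (S :+ D) :+ O) refl q (u + v) 1# D ⟩
          q * ((u + v) + D) + 1#             ≈⟨ +-congʳ (*-congˡ (-‿inverseʳ (u + v))) ⟩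
          q * 0# + 1#                        ≈⟨ +-congʳ (zeroʳ q) ⟩
          0# + 1#                            ≈⟨ +-identityˡ 1# ⟩
          1#                                 ∎

  log₂-subadditive : ∀ {x y} → 0# < x → 0# < y → log₂ (x * y) ≤ log₂ x + log₂ y
  log₂-subadditive {x} {y} 0<x 0<y = begin
    log₂ (x * y)
      ≤⟨ x≤x+y (log₂ (x * y)) (log₂-⁻¹ 0<y) ⟩
    log₂ (x * y) + (log₂ y + log₂ (y ⁻¹))
      ≈⟨ solve 3 (λ a b c → a :+ (b :+ c) := (a :+ c) :+ b) refl _ _ _ ⟩
    (log₂ (x * y) + log₂ (y ⁻¹)) + log₂ y
      ≤⟨ +-monoˡ-≤ (log₂ y) (log₂-superadditive 0<xy 0<y⁻¹) ⟩
    log₂ ((x * y) * y ⁻¹) + log₂ y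
      -- `sup` is not assumed to respect any equality of predicates, so x y / y is replaced by x
      -- through monotonicity of `log₂`.
      ≤⟨ +-monoˡ-≤ (log₂ y) (log₂-mono-≤ (*-pos 0<xy 0<y⁻¹) (≤-reflexive xy/y≈x)) ⟩
    log₂ x + log₂ y ∎
    where
    0<xy = *-pos 0<x 0<y
    0<y⁻¹ = ⁻¹-pos 0<y

    xy/y≈x : (x * y) * y ⁻¹ ≈ x
    xy/y≈x =
      trans (*-assoc x y (y ⁻¹)) (trans (*-congˡ (⁻¹-inverseʳ y (0<⇒≉0 0<y))) (*-identityʳ x))

-- Finite sums.

module FiniteSums (ℝ : CompleteOrderedField) where
  open CompleteOrderedField ℝ
  open OrderedField ℝ

  private variable
    A B : Set

  -- `Σ[ X ] f` is definitionally `∑ f (elements X)`; an arbitrary list makes induction possible.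
  ∑ : (A → Carrier) → List A → Carrier
  ∑ f xs = foldr _+_ 0# (map f xs)

  ∑-mono-≤ : ∀ {f h : A → Carrier} → (∀ x → f x ≤ h x) → ∀ xs → ∑ f xs ≤ ∑ h xs
  ∑-mono-≤ f≤h []       = ≤-refl
  ∑-mono-≤ f≤h (x ∷ xs) = +-mono-≤ (f≤h x) (∑-mono-≤ f≤h xs)

  ∑-nonneg : ∀ {f : A → Carrier} → (∀ x → 0# ≤ f x) → ∀ xs → 0# ≤ ∑ f xs
  ∑-nonneg 0≤f []       = ≤-refl
  ∑-nonneg 0≤f (x ∷ xs) = ≤-trans (0≤f x) (x≤x+y _ (∑-nonneg 0≤f xs))

  ∑-pos : ∀ {f : A → Carrier} → (∀ x → 0# ≤ f x) → ∀ {x xs} → x ∈ xs → 0# < f x → 0# < ∑ f xs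
  ∑-pos {f = f} 0≤f {xs = y ∷ xs} (here ≡.refl) 0<fx =
    <-≤-trans 0<fx (x≤x+y (f y) (∑-nonneg 0≤f xs))
  ∑-pos {f = f} 0≤f {xs = y ∷ xs} (there x∈xs)  0<fx = begin-strict
    0#             <⟨ ∑-pos 0≤f x∈xs 0<fx ⟩
    ∑ f xs         ≤⟨ x≤x+y (∑ f xs) (0≤f y) ⟩
    ∑ f xs + f y   ≈⟨ +-comm (∑ f xs) (f y) ⟩
    f y + ∑ f xs   ∎

  ∑-≉0⇒∃≉0 : ∀ {f : A → Carrier} xs → ∑ f xs ≉ 0# → ∃[ x ] f x ≉ 0#
  ∑-≉0⇒∃≉0 []       ∑≉0 = contradiction refl ∑≉0
  ∑-≉0⇒∃≉0 {f = f} (x ∷ xs) ∑≉0 with f x ≟ 0#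
  ... | no  fx≉0 = x , fx≉0
  ... | yes fx≈0 = ∑-≉0⇒∃≉0 xs λ ∑≈0 → ∑≉0 (trans (+-cong fx≈0 ∑≈0) (+-identityˡ 0#))

  ∑-*ˡ : ∀ c (f : A → Carrier) xs → c * ∑ f xs ≈ ∑ (λ x → c * f x) xs
  ∑-*ˡ c f []       = zeroʳ c
  ∑-*ˡ c f (x ∷ xs) = trans (distribˡ c (f x) (∑ f xs)) (+-congˡ (∑-*ˡ c f xs))

  -- This is the shape to which `cartesianProduct` unfolds at a cons.
  ∑-map-++ : ∀ (f : B → Carrier) (h : A → B) xs ys → ∑ f (map h xs ++ ys) ≈ ∑ (f ∘ h) xs + ∑ f ys
  ∑-map-++ f h []       ys = sym (+-identityˡ (∑ f ys))
  ∑-map-++ f h (x ∷ xs) ys = trans (+-congˡ (∑-map-++ f h xs ys)) (sym (+-assoc _ _ _))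

  ∑-*-∑ : ∀ (f : A → Carrier) (h : B → Carrier) xs ys →
          ∑ f xs * ∑ h ys ≈ ∑ (λ (x , y) → f x * h y) (cartesianProduct xs ys)
  ∑-*-∑ f h []       ys = zeroˡ (∑ h ys)
  ∑-*-∑ f h (x ∷ xs) ys = begin-equality
    (f x + ∑ f xs) * ∑ h ys               ≈⟨ distribʳ (∑ h ys) (f x) (∑ f xs) ⟩
    f x * ∑ h ys + ∑ f xs * ∑ h ys        ≈⟨ +-cong (∑-*ˡ (f x) h ys) (∑-*-∑ f h xs ys) ⟩
    ∑ (λ y → f x * h y) ys + ∑ (λ (x , y) → f x * h y) (cartesianProduct xs ys)
                                          ≈⟨ ∑-map-++ _ (x ,_) ys (cartesianProduct xs ys) ⟨
    ∑ (λ (x , y) → f x * h y) (cartesianProduct (x ∷ xs) ys) ∎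

-- Maxima of finite lists.

module Maxima (ℝ : CompleteOrderedField) where
  open CompleteOrderedField ℝ
  open OrderedField ℝ
  open Leakage ℝ
  open Extrema totalOrder using (⊥≤max; xs≤max; argmax-sel)

  ≤maximum : ∀ {x xs} → x ∈ xs → x ≤ maximum xs
  ≤maximum {xs = y ∷ ys} (here ≡.refl) = ⊥≤max y ys
  ≤maximum {xs = y ∷ ys} (there x∈ys)  = All.lookup (xs≤max y ys) x∈ys

  -- The membership hypothesis serves to exclude the empty list, where `maximum` has the default
  -- value 0. On a cons, the maximum is an argmax of the identity seeded with the head.
  maximum-∈ : ∀ {x xs} → x ∈ xs → maximum xs ∈ xs
  maximum-∈ {xs = y ∷ ys} _ with argmax-sel (λ z → z) y ys
  ... | inj₁ max≡y  = here max≡y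
  ... | inj₂ max∈ys = there max∈ys

  ≤Max : ∀ X f x → f x ≤ Max[ X ] f
  ≤Max X f x = ≤maximum (∈-map⁺ f (complete X x))

  Max-attained : ∀ X f → ∃[ x ] Max[ X ] f ≡ f x
  Max-attained X f with ∈-map⁻ f (maximum-∈ (∈-map⁺ f (complete X (nonempty X))))
  ... | x , _ , Max≡fx = x , Max≡fx

-- The inequality for joint gain functions.

module JointGain (ℝ : CompleteOrderedField) (X₁ X₂ W₁ W₂ : FiniteSet) where
  open CompleteOrderedField ℝ
  open Leakage ℝ
  open Joint X₁ X₂ W₁ W₂

  module _
    (g₁ : Elem W₁ × Elem X₁ → Carrier) (g₁-gain : IsGain W₁ X₁ g₁)
    (g₂ : Elem W₂ × Elem X₂ → Carrier) (g₂-gain : IsGain W₂ X₂ g₂)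
    (g : Elem (W₁ ⊗ W₂) × Elem (X₁ ⊗ X₂) → Carrier) (g-joint : IsJointGain g₁ g₂ g)
    (π : Elem (X₁ ⊗ X₂) → Carrier) (π-prior : IsPrior (X₁ ⊗ X₂) π)
    (π-supported : JointlySupported π)
    (0<V : 0# < V (W₁ ⊗ W₂) (X₁ ⊗ X₂) g π)
    where
    open OrderedField ℝ
    open FiniteSums ℝ
    open Maxima ℝ
    open Logarithm ℝ
    open IsPrior π-prior using (nonneg)

    W = W₁ ⊗ W₂
    X = X₁ ⊗ X₂

    π₁ : Elem X₁ → Carrier
    π₁ = marginal₁ π

    π₂ : Elem X₂ → Carrier
    π₂ = marginal₂ π

    V₁ V₂ V₁₂ M : Carrier
    V₁  = V W₁ X₁ g₁ π₁
    V₂  = V W₂ X₂ g₂ π₂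
    V₁₂ = V W X g π
    M   = Mᵐᵃˣ g₁ g₂ g π

    gain₁ : Elem W₁ → Elem X₁ → Carrier
    gain₁ w₁ x₁ = π₁ x₁ * g₁ (w₁ , x₁)

    gain₂ : Elem W₂ → Elem X₂ → Carrier
    gain₂ w₂ x₂ = π₂ x₂ * g₂ (w₂ , x₂)

    gain : Elem W → Elem X → Carrier
    gain w x = π x * g (w , x)

    gain₁-nonneg : ∀ w₁ x₁ → 0# ≤ gain₁ w₁ x₁
    gain₁-nonneg w₁ x₁ =
      *-nonneg (∑-nonneg (λ x₂ → nonneg (x₁ , x₂)) (elements X₂)) (proj₁ (g₁-gain w₁ x₁))

    gain₂-nonneg : ∀ w₂ x₂ → 0# ≤ gain₂ w₂ x₂
    gain₂-nonneg w₂ x₂ =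
      *-nonneg (∑-nonneg (λ x₁ → nonneg (x₁ , x₂)) (elements X₁)) (proj₁ (g₂-gain w₂ x₂))

    gain-nonneg : ∀ w x → 0# ≤ gain w x
    gain-nonneg w x = *-nonneg (nonneg x) (proj₁ (proj₁ g-joint w x))

    ratio≤M : ∀ w x → gain w x ≉ 0# → ratio g₁ g₂ g π (w , x) ≤ M
    ratio≤M w x gain≉0 =
      ≤maximum (∈-map⁺ _ (∈-filter⁺ (𝒮? g₁ g₂ g π) (complete (W ⊗ X) (w , x)) gain≉0))

    module _ (w₁ : Elem W₁) (w₂ : Elem W₂) (x₁ : Elem X₁) (x₂ : Elem X₂) where

      private
        w = w₁ , w₂
        x = x₁ , x₂

      -- Such points lie outside `𝒮`, so M gives no control there. Grouping priors with priors and
      -- gains with gains produces the two products that the hypotheses on π and g speak about.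
      gain₁*gain₂≈0 : gain w x ≈ 0# → gain₁ w₁ x₁ * gain₂ w₂ x₂ ≈ 0#
      gain₁*gain₂≈0 gain≈0 = trans rearrange ππgg≈0
        where
        rearrange : gain₁ w₁ x₁ * gain₂ w₂ x₂ ≈ (π₁ x₁ * π₂ x₂) * (g₁ (w₁ , x₁) * g₂ (w₂ , x₂))
        rearrange = solve 4 (λ a b c d → (a :* b) :* (c :* d) := (a :* c) :* (b :* d)) refl _ _ _ _

        ππgg≈0 : (π₁ x₁ * π₂ x₂) * (g₁ (w₁ , x₁) * g₂ (w₂ , x₂)) ≈ 0#
        ππgg≈0 with π₁ x₁ * π₂ x₂ ≟ 0# | g (w , x) ≟ 0#
        ... | yes ππ≈0 | _       = trans (*-congʳ ππ≈0) (zeroˡ _)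
        ... | no  _    | yes g≈0 =
          trans (*-congˡ (Equivalence.to (proj₂ g-joint w₁ w₂ x₁ x₂) g≈0)) (zeroʳ _)
        -- This case cannot occur: joint support makes π nonzero, and then π g is nonzero too.
        ... | no  ππ≉0 | no  g≉0 = contradiction gain≈0 (*-≉0 (π-supported x₁ x₂ ππ≉0) g≉0)

      gain₁*gain₂≤M*gain : gain₁ w₁ x₁ * gain₂ w₂ x₂ ≤ M * gain w x
      gain₁*gain₂≤M*gain with gain w x ≟ 0#
      ... | yes gain≈0 = ≤-reflexive (begin-equality
        gain₁ w₁ x₁ * gain₂ w₂ x₂             ≈⟨ gain₁*gain₂≈0 gain≈0 ⟩
        0#                                    ≈⟨ zeroʳ M ⟨
        M * 0#                                ≈⟨ *-congˡ gain≈0 ⟨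
        M * gain w x                          ∎)
      ... | no  gain≉0 = begin
        gain₁ w₁ x₁ * gain₂ w₂ x₂             ≈⟨ y/x*x≈y gain≉0 _ ⟨
        ratio g₁ g₂ g π (w , x) * gain w x    ≤⟨ *-monoˡ-≤ (gain-nonneg w x) (ratio≤M w x gain≉0) ⟩
        M * gain w x                          ∎

    -- A positive maximum is attained at some w, and a nonzero sum has a nonzero term. The point
    -- found lies in `𝒮`, so M is the maximum of a nonempty list.
    ∃-gain≉0 : ∃[ w ] ∃[ x ] gain w x ≉ 0#
    ∃-gain≉0 with Max-attained W (λ w → Σ[ X ] (gain w))
    ... | w , V≡ = w , ∑-≉0⇒∃≉0 (elements X) λ Σ≈0 → 0<⇒≉0 0<V (trans (reflexive V≡) Σ≈0)

    -- The logarithm laws require positive arguments. One point with π g nonzero yields a positive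
    -- term in both marginal sums and a positive ratio.
    0<V₁,V₂,M : 0# < V₁ × 0# < V₂ × 0# < M
    0<V₁,V₂,M with ∃-gain≉0
    ... | w@(w₁ , w₂) , x@(x₁ , x₂) , gain≉0 =
        <-≤-trans (∑-pos (gain₁-nonneg w₁) (complete X₁ x₁) 0<gain₁) (≤Max W₁ _ w₁)
      , <-≤-trans (∑-pos (gain₂-nonneg w₂) (complete X₂ x₂) 0<gain₂) (≤Max W₂ _ w₂)
      , <-≤-trans (*-pos (*-pos 0<gain₁ 0<gain₂) (⁻¹-pos (gain-nonneg w x , gain≉0 ∘ sym)))
          (ratio≤M w x gain≉0)
      where
      0<π : 0# < π x
      0<π = nonneg x , λ 0≈π → gain≉0 (trans (*-congʳ (sym 0≈π)) (zeroˡ _))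

      -- Here the joint gain condition is used from right to left: a vanishing product would force
      -- g, and hence π g, to vanish.
      g₁*g₂≉0 : g₁ (w₁ , x₁) * g₂ (w₂ , x₂) ≉ 0#
      g₁*g₂≉0 g₁g₂≈0 = gain≉0
        (trans (*-congˡ (Equivalence.from (proj₂ g-joint w₁ w₂ x₁ x₂) g₁g₂≈0)) (zeroʳ _))

      0<gain₁ : 0# < gain₁ w₁ x₁
      -- The marginal is positive because π x is one of its summands.
      0<gain₁ = *-pos (∑-pos (λ x₂ → nonneg (x₁ , x₂)) (complete X₂ x₂) 0<π)
        (proj₁ (g₁-gain w₁ x₁) , λ 0≈g₁ → g₁*g₂≉0 (trans (*-congʳ (sym 0≈g₁)) (zeroˡ _)))

      0<gain₂ : 0# < gain₂ w₂ x₂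
      0<gain₂ = *-pos (∑-pos (λ x₁ → nonneg (x₁ , x₂)) (complete X₁ x₁) 0<π)
        (proj₁ (g₂-gain w₂ x₂) , λ 0≈g₂ → g₁*g₂≉0 (trans (*-congˡ (sym 0≈g₂)) (zeroʳ _)))

    0<V₁ = proj₁ 0<V₁,V₂,M
    0<V₂ = proj₁ (proj₂ 0<V₁,V₂,M)
    0<M  = proj₂ (proj₂ 0<V₁,V₂,M)

    V₁*V₂≤M*V₁₂ : V₁ * V₂ ≤ M * V₁₂
    V₁*V₂≤M*V₁₂
      with Max-attained W₁ (λ w₁ → Σ[ X₁ ] (gain₁ w₁))
         | Max-attained W₂ (λ w₂ → Σ[ X₂ ] (gain₂ w₂))
    ... | w₁ , V₁≡ | w₂ , V₂≡ = begin
      V₁ * V₂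
        ≡⟨ ≡.cong₂ _*_ V₁≡ V₂≡ ⟩
      Σ[ X₁ ] (gain₁ w₁) * Σ[ X₂ ] (gain₂ w₂)
        ≈⟨ ∑-*-∑ (gain₁ w₁) (gain₂ w₂) (elements X₁) (elements X₂) ⟩
      (Σ[ X ] λ (x₁ , x₂) → gain₁ w₁ x₁ * gain₂ w₂ x₂)
        ≤⟨ ∑-mono-≤ (λ (x₁ , x₂) → gain₁*gain₂≤M*gain w₁ w₂ x₁ x₂) (elements X) ⟩
      (Σ[ X ] λ x → M * gain (w₁ , w₂) x)
        ≈⟨ ∑-*ˡ M (gain (w₁ , w₂)) (elements X) ⟨
      M * Σ[ X ] (gain (w₁ , w₂))
        -- The separately optimal guesses form one admissible pair, not necessarily an optimal one
        -- for g.
        ≤⟨ *-monoʳ-≤ (proj₁ 0<M) (≤Max W _ (w₁ , w₂)) ⟩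
      M * V₁₂ ∎

    log₂V₁+log₂V₂≤log₂M+log₂V₁₂ : log₂ V₁ + log₂ V₂ ≤ log₂ M + log₂ V₁₂
    log₂V₁+log₂V₂≤log₂M+log₂V₁₂ = begin
      log₂ V₁ + log₂ V₂    ≤⟨ log₂-superadditive 0<V₁ 0<V₂ ⟩
      log₂ (V₁ * V₂)       ≤⟨ log₂-mono-≤ (*-pos 0<V₁ 0<V₂) V₁*V₂≤M*V₁₂ ⟩
      log₂ (M * V₁₂)       ≤⟨ log₂-subadditive 0<M 0<V ⟩
      log₂ M + log₂ V₁₂    ∎

    H≤H₁+H₂+log₂M : H W X g π ≤ (H W₁ X₁ g₁ π₁ + H W₂ X₂ g₂ π₂) + log₂ M
    -- Adding all three logarithms of vulnerabilities to both sides removes the negations and leaves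
    -- the inequality just proved.
    H≤H₁+H₂+log₂M = +-cancelʳ-≤ ((log₂ V₁ + log₂ V₂) + log₂ V₁₂) (begin
      - log₂ V₁₂ + ((log₂ V₁ + log₂ V₂) + log₂ V₁₂)
        ≈⟨ +-comm _ _ ⟩
      ((log₂ V₁ + log₂ V₂) + log₂ V₁₂) + - log₂ V₁₂
        ≈⟨ x+y-y≈x _ (log₂ V₁₂) ⟩
      log₂ V₁ + log₂ V₂
        ≤⟨ log₂V₁+log₂V₂≤log₂M+log₂V₁₂ ⟩
      log₂ M + log₂ V₁₂
        ≈⟨ trans (+-congʳ (+-cong (-‿inverseˡ (log₂ V₁)) (-‿inverseˡ (log₂ V₂)))) 0+0+ ⟨
      ((- log₂ V₁ + log₂ V₁) + (- log₂ V₂ + log₂ V₂)) + (log₂ M + log₂ V₁₂)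
        -- The negated logarithms enter the semiring solver as independent atoms a′ and b′; their
        -- cancellation is the preceding step.
        ≈⟨ solve 6 (λ a′ a b′ b m v → ((a′ :+ a) :+ (b′ :+ b)) :+ (m :+ v) :=
             ((a′ :+ b′) :+ m) :+ ((a :+ b) :+ v)) refl _ _ _ _ _ _ ⟩
      ((- log₂ V₁ + - log₂ V₂) + log₂ M) + ((log₂ V₁ + log₂ V₂) + log₂ V₁₂) ∎)
      where
      0+0+ : ∀ {z} → (0# + 0#) + z ≈ z
      0+0+ = trans (+-congʳ (+-identityˡ 0#)) (+-identityˡ _)

proposition3p6 :
  (ℝ : CompleteOrderedField) (X₁ X₂ W₁ W₂ : FiniteSet) →
  let open CompleteOrderedField ℝ
      open Leakage ℝ
      open Joint X₁ X₂ W₁ W₂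
  in
  (g₁ : Elem W₁ × Elem X₁ → Carrier) → IsGain W₁ X₁ g₁ →
  (g₂ : Elem W₂ × Elem X₂ → Carrier) → IsGain W₂ X₂ g₂ →
  (g : Elem (W₁ ⊗ W₂) × Elem (X₁ ⊗ X₂) → Carrier) → IsJointGain g₁ g₂ g →
  (π : Elem (X₁ ⊗ X₂) → Carrier) → IsPrior (X₁ ⊗ X₂) π →
  JointlySupported π →
  0# < V (W₁ ⊗ W₂) (X₁ ⊗ X₂) g π →
  H (W₁ ⊗ W₂) (X₁ ⊗ X₂) g π
    ≤ (H W₁ X₁ g₁ (marginal₁ π) + H W₂ X₂ g₂ (marginal₂ π)) + log₂ (Mᵐᵃˣ g₁ g₂ g π)
proposition3p6 ℝ X₁ X₂ W₁ W₂ g₁ g₁-gain g₂ g₂-gain g g-joint π π-prior π-supported 0<V =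
  JointGain.H≤H₁+H₂+log₂M ℝ X₁ X₂ W₁ W₂ g₁ g₁-gain g₂ g₂-gain g g-joint π π-prior π-supported 0<V
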